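{- For any two graphs $G_1$ and $G_2$, $\chi_L(G_1+G_2)=\chi_{L_2}(G_1)+\chi_{L_2}(G_2)$.
   Context: All graphs are finite and simple (not necessarily connected for $G_1,G_2$). A proper $k$-coloring of $G$ is a map $f$ from $V(G)$ onto $[k]=\{1,\dots,k\}$ with adjacent vertices receiving different colors; for $S\subseteq V(G)$, $f(S)=\{f(u):u\in S\}$, and $N_G(u)$ is the set of neighbors of $u$. A proper $k$-coloring $f$ is a neighbor locating coloring if for any two distinct vertices $u,v$ with $f(u)=f(v)$ we have $f(N_G(u))\ne f(N_G(v))$; the neighbor locating chromatic number $\chi_{L_2}(G)$ is the minimum number of colors in a neighbor locating coloring of $G$. For a connected graph $G$ with proper $k$-coloring $f$ and color classes $V_i=f^{ -1}(i)$, the color code of $v$ is $(d(v,V_1),\dots,d(v,V_k))$, where $d(v,S)=\min_{x\in S}d(v,x)$; $f$ is a locating coloring if distinct vertices have distinct color codes, and $\chi_L(G)$ is the minimum number of colors in a locating coloring. The join $G_1+G_2$ is the disjoint union of $G_1$ and $G_2$ together with all edges joining a vertex of $G_1$ to a vertex of $G_2$. -}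

module Defs where

open import Data.Fin.Base using (Fin; zero; suc; splitAt; _↑ˡ_; _↑ʳ_; finToFun; funToFin)
open import Data.Fin.Properties using (_≟_; any?; all?; splitAt-↑ˡ; splitAt-↑ʳ; finToFun-funToFin)
open import Data.Nat.Base using (ℕ; zero; suc; _+_; _^_; _≤_; z≤n; s≤s; NonZero)
open import Data.Nat.Properties using (≤-antisym; n≤0⇒n≡0) renaming (_≟_ to _≟ℕ_)
open import Data.Product.Base using (∃; _×_; _,_; proj₁; proj₂; map₂)
open import Data.Sum.Base using (_⊎_; inj₁; inj₂)
open import Data.Unit.Base using (⊤; tt)
open import Data.Empty using (⊥-elim)
open import Data.Vec.Base using (Vec; tabulate; lookup)
open import Data.Vec.Properties using (≡-dec; lookup∘tabulate; tabulate-cong)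
open import Function.Base using (_∘_; id)
open import Function.Definitions using (StrictlySurjective)
open import Level using (0ℓ)
open import Relation.Binary.Core using (Rel)
open import Relation.Binary.Definitions using (Symmetric; Irreflexive) renaming (Decidable to Decidable₂)
open import Relation.Binary.PropositionalEquality.Core using (_≡_; _≢_; _≗_; refl; sym; trans; cong; subst; subst₂)
open import Relation.Nullary.Decidable.Core using (Dec; yes; no; map′; _×-dec_; _→-dec_; ¬?)
open import Relation.Nullary.Negation.Core using (¬_)
open import Relation.Unary using (Pred; Decidable; _∈_; _⊆_; _≐_)

record IsMinimum (P : Pred ℕ 0ℓ) (m : ℕ) : Set where
  field
    attained : P m
    least    : ∀ n → P n → m ≤ n

open IsMinimum

∃-minimum : {P : Pred ℕ 0ℓ} → Decidable P → ∀ n → P n → ∃ (IsMinimum P)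
∃-minimum {P} P? n p with P? 0
∃-minimum {P} P? n       p | yes p₀ = 0 , record { attained = p₀ ; least = λ _ _ → z≤n }
∃-minimum {P} P? zero    p | no ¬p₀ = ⊥-elim (¬p₀ p)
∃-minimum {P} P? (suc n) p | no ¬p₀ with ∃-minimum (P? ∘ suc) n p
... | m , isMin = suc m , record { attained = attained isMin ; least = bound }
  where
  bound : ∀ j → P j → suc m ≤ j
  bound zero    p₀ = ⊥-elim (¬p₀ p₀)
  bound (suc j) pⱼ = s≤s (least isMin j pⱼ)

min : {P : Pred ℕ 0ℓ} → Decidable P → ∃ P → ℕ
min P? (n , p) = proj₁ (∃-minimum P? n p)

min-isMinimum : {P : Pred ℕ 0ℓ} (P? : Decidable P) (p : ∃ P) → IsMinimum P (min P? p)
min-isMinimum P? (n , p) = proj₂ (∃-minimum P? n p)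

min-cong : {P Q : Pred ℕ 0ℓ} (P? : Decidable P) (p : ∃ P) (Q? : Decidable Q) (q : ∃ Q) →
           P ≐ Q → min P? p ≡ min Q? q
min-cong P? p Q? q (P⊆Q , Q⊆P) = ≤-antisym
  (least (min-isMinimum P? p) _ (Q⊆P (attained (min-isMinimum Q? q))))
  (least (min-isMinimum Q? q) _ (P⊆Q (attained (min-isMinimum P? p))))

-- The vertex set is nonempty, as usual: the join with the null graph need
-- not be connected.
record Graph : Set₁ where
  field
    order    : ℕ
    nonEmpty : NonZero order
    Adj      : Rel (Fin order) 0ℓ
    adj?     : Decidable₂ Adj
    symm     : Symmetric Adj
    irrefl   : Irreflexive _≡_ Adj

  Vertex : Set
  Vertex = Fin order

open Graph using (Vertex)

N : (G : Graph) → Vertex G → Pred (Vertex G) 0ℓ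
N G u = Graph.Adj G u

data Walk (G : Graph) : Vertex G → Vertex G → ℕ → Set where
  []  : ∀ {u} → Walk G u u 0
  _∷_ : ∀ {u v w n} → Graph.Adj G u v → Walk G v w n → Walk G u w (suc n)

walk? : (G : Graph) (u v : Vertex G) → Decidable (Walk G u v)
walk? G u v zero = map′ (λ { refl → [] }) (λ { [] → refl }) (u ≟ v)
walk? G u v (suc n) =
  map′ (λ { (_ , a , w) → a ∷ w }) (λ { (a ∷ w) → _ , a , w })
       (any? λ x → Graph.adj? G u x ×-dec walk? G x v n)

Connected : Graph → Set
Connected G = ∀ u v → ∃ (Walk G u v)

dist : (G : Graph) → Connected G → Vertex G → Vertex G → ℕ
dist G conn u v = min (walk? G u v) (conn u v)

DistancesTo : (G : Graph) → Connected G → Vertex G → Pred (Vertex G) 0ℓ → Pred ℕ 0ℓ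
DistancesTo G conn v S n = ∃ λ x → x ∈ S × dist G conn v x ≡ n

distancesTo? : (G : Graph) (conn : Connected G) (v : Vertex G) {S : Pred (Vertex G) 0ℓ} →
               Decidable S → Decidable (DistancesTo G conn v S)
distancesTo? G conn v S? n = any? λ x → S? x ×-dec (dist G conn v x ≟ℕ n)

distancesTo-nonEmpty : (G : Graph) (conn : Connected G) (v : Vertex G) {S : Pred (Vertex G) 0ℓ} →
                       ∃ S → ∃ (DistancesTo G conn v S)
distancesTo-nonEmpty G conn v (x , x∈S) = dist G conn v x , x , x∈S , refl

distSet : (G : Graph) → Connected G → Vertex G →
          {S : Pred (Vertex G) 0ℓ} → Decidable S → ∃ S → ℕ
distSet G conn v S? s = min (distancesTo? G conn v S?) (distancesTo-nonEmpty G conn v s)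

distSet-isMinimum : (G : Graph) (conn : Connected G) (v : Vertex G)
                    {S : Pred (Vertex G) 0ℓ} (S? : Decidable S) (s : ∃ S) →
                    IsMinimum (DistancesTo G conn v S) (distSet G conn v S? s)
distSet-isMinimum G conn v S? s =
  min-isMinimum (distancesTo? G conn v S?) (distancesTo-nonEmpty G conn v s)

module Join (G₁ G₂ : Graph) where
  private
    module G₁ = Graph G₁
    module G₂ = Graph G₂

  Adj⊎ : Rel (Vertex G₁ ⊎ Vertex G₂) 0ℓ
  Adj⊎ (inj₁ u) (inj₁ v) = G₁.Adj u v
  Adj⊎ (inj₁ _) (inj₂ _) = ⊤
  Adj⊎ (inj₂ _) (inj₁ _) = ⊤
  Adj⊎ (inj₂ u) (inj₂ v) = G₂.Adj u v

  adj⊎? : Decidable₂ Adj⊎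
  adj⊎? (inj₁ u) (inj₁ v) = G₁.adj? u v
  adj⊎? (inj₁ _) (inj₂ _) = yes tt
  adj⊎? (inj₂ _) (inj₁ _) = yes tt
  adj⊎? (inj₂ u) (inj₂ v) = G₂.adj? u v

  symm⊎ : Symmetric Adj⊎
  symm⊎ {inj₁ _} {inj₁ _} a = G₁.symm a
  symm⊎ {inj₁ _} {inj₂ _} _ = tt
  symm⊎ {inj₂ _} {inj₁ _} _ = tt
  symm⊎ {inj₂ _} {inj₂ _} a = G₂.symm a

  irrefl⊎ : Irreflexive _≡_ Adj⊎
  irrefl⊎ {inj₁ _} refl = G₁.irrefl refl
  irrefl⊎ {inj₂ _} refl = G₂.irrefl refl

  split : Fin (G₁.order + G₂.order) → Vertex G₁ ⊎ Vertex G₂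
  split = splitAt G₁.order

  nonZero-+ : ∀ {m n} → NonZero m → NonZero (m + n)
  nonZero-+ {suc m} _ = _

  graph : Graph
  graph = record
    { order    = G₁.order + G₂.order
    ; nonEmpty = nonZero-+ G₁.nonEmpty
    ; Adj      = λ u v → Adj⊎ (split u) (split v)
    ; adj?     = λ u v → adj⊎? (split u) (split v)
    ; symm     = λ {u} {v} → symm⊎ {split u} {split v}
    ; irrefl   = λ { {u} refl → irrefl⊎ {split u} refl }
    }

  someVertex : ∀ {n} → NonZero n → Fin n
  someVertex {suc n} _ = zero

  connected : Connected graph
  connected u v = go (split u) (split v) refl refl
    where
    x₁ : Fin (G₁.order + G₂.order)
    x₁ = someVertex G₁.nonEmpty ↑ˡ G₂.order

    x₂ : Fin (G₁.order + G₂.order)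
    x₂ = G₁.order ↑ʳ someVertex G₂.nonEmpty

    split-x₁ : split x₁ ≡ inj₁ (someVertex G₁.nonEmpty)
    split-x₁ = splitAt-↑ˡ G₁.order _ G₂.order

    split-x₂ : split x₂ ≡ inj₂ (someVertex G₂.nonEmpty)
    split-x₂ = splitAt-↑ʳ G₁.order G₂.order _

    edge : ∀ {x y a b} → split x ≡ a → split y ≡ b → Adj⊎ a b → Graph.Adj graph x y
    edge p q = subst₂ Adj⊎ (sym p) (sym q)

    go : ∀ a b → split u ≡ a → split v ≡ b → ∃ (Walk graph u v)
    go (inj₁ _) (inj₁ _) p q = 2 , edge {u} {x₂} p split-x₂ tt ∷ (edge {x₂} {v} split-x₂ q tt ∷ [])
    go (inj₁ _) (inj₂ _) p q = 1 , edge {u} {v} p q tt ∷ []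
    go (inj₂ _) (inj₁ _) p q = 1 , edge {u} {v} p q tt ∷ []
    go (inj₂ _) (inj₂ _) p q = 2 , edge {u} {x₁} p split-x₁ tt ∷ (edge {x₁} {v} split-x₁ q tt ∷ [])

infixl 6 _+ᴳ_

_+ᴳ_ : Graph → Graph → Graph
_+ᴳ_ = Join.graph

+ᴳ-connected : ∀ G₁ G₂ → Connected (G₁ +ᴳ G₂)
+ᴳ-connected = Join.connected

record IsProperColoring (G : Graph) {k : ℕ} (f : Vertex G → Fin k) : Set where
  field
    onto   : StrictlySurjective _≡_ f
    proper : ∀ {u v} → Graph.Adj G u v → f u ≢ f v

open IsProperColoring

image : ∀ {A B : Set} → (A → B) → Pred A 0ℓ → Pred B 0ℓ
image f S c = ∃ λ x → x ∈ S × f x ≡ c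

colorClass : ∀ {A : Set} {k} → (A → Fin k) → Fin k → Pred A 0ℓ
colorClass f i v = f v ≡ i

record IsNeighborLocating (G : Graph) {k : ℕ} (f : Vertex G → Fin k) : Set where
  field
    isProper : IsProperColoring G f
    locating : ∀ u v → u ≢ v → f u ≡ f v → ¬ (image f (N G u) ≐ image f (N G v))

colorCode : (G : Graph) → Connected G → ∀ {k} (f : Vertex G → Fin k) →
            IsProperColoring G f → Vertex G → Vec ℕ k
colorCode G conn f isProper v =
  tabulate λ i → distSet G conn v {colorClass f i} (λ x → f x ≟ i) (onto isProper i)

record IsLocating (G : Graph) (conn : Connected G) {k : ℕ} (f : Vertex G → Fin k) : Set where
  field
    isProper : IsProperColoring G f
    locating : ∀ u v → u ≢ v → colorCode G conn f isProper u ≢ colorCode G conn f isProper v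

HasNeighborLocating : Graph → Pred ℕ 0ℓ
HasNeighborLocating G k = ∃ λ (f : Vertex G → Fin k) → IsNeighborLocating G f

HasLocating : (G : Graph) → Connected G → Pred ℕ 0ℓ
HasLocating G conn k = ∃ λ (f : Vertex G → Fin k) → IsLocating G conn f

-- Both kinds of coloring exist and can be searched for, so that the minima
-- defining the chromatic numbers exist.

∃-function? : ∀ {m n} {P : Pred (Fin m → Fin n) 0ℓ} →
              (∀ {f g} → f ≗ g → P f → P g) → Decidable P → Dec (∃ P)
∃-function? {m} {n} {P} resp P? =
  map′ (λ { (i , p) → finToFun i , p })
       (λ { (f , p) → funToFin f , resp (λ x → sym (finToFun-funToFin f x)) p })
       (any? {n = n ^ m} λ i → P? (finToFun i))

module _ (G : Graph) where
  private
    V = Vertex G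

  proper-resp : ∀ {k} {f g : V → Fin k} → f ≗ g → IsProperColoring G f → IsProperColoring G g
  proper-resp f≗g p = record
    { onto   = λ c → map₂ (λ {x} e → trans (sym (f≗g x)) e) (onto p c)
    ; proper = λ {u} {v} a e → proper p a (trans (f≗g u) (trans e (sym (f≗g v))))
    }

  proper? : ∀ {k} → Decidable (IsProperColoring G {k})
  proper? f = map′
    (λ { (s , p) → record { onto = s ; proper = λ {u} {v} → p u v } })
    (λ p → onto p , λ u v → proper p)
    ((all? λ c → any? λ x → f x ≟ c) ×-dec
     (all? λ u → all? λ v → Graph.adj? G u v →-dec ¬? (f u ≟ f v)))

  image-resp : ∀ {k} {f g : V → Fin k} (S : Pred V 0ℓ) → f ≗ g → image f S ⊆ image g S
  image-resp S f≗g (x , s , e) = x , s , trans (sym (f≗g x)) e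

  neighborLocating-resp : ∀ {k} {f g : V → Fin k} → f ≗ g →
                          IsNeighborLocating G f → IsNeighborLocating G g
  neighborLocating-resp {f = f} {g} f≗g l = record
    { isProper = proper-resp f≗g (IsNeighborLocating.isProper l)
    ; locating = λ u v u≢v e (p , q) → IsNeighborLocating.locating l u v u≢v
        (trans (f≗g u) (trans e (sym (f≗g v))))
        ( (λ i → image-resp (N G v) g≗f (p (image-resp (N G u) f≗g i)))
        , (λ i → image-resp (N G u) g≗f (q (image-resp (N G v) f≗g i))))
    }
    where
    g≗f : g ≗ f
    g≗f x = sym (f≗g x)

  neighborLocating? : ∀ {k} → Decidable (IsNeighborLocating G {k})
  neighborLocating? f = map′
    (λ { (p , l) → record { isProper = p ; locating = l } })
    (λ l → IsNeighborLocating.isProper l , IsNeighborLocating.locating l)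
    (proper? f ×-dec
     (all? λ u → all? λ v → ¬? (u ≟ v) →-dec ((f u ≟ f v) →-dec ¬? (≐? u v))))
    where
    image? : ∀ u → Decidable (image f (N G u))
    image? u c = any? λ x → Graph.adj? G u x ×-dec (f x ≟ c)

    ⊆? : ∀ u v → Dec (image f (N G u) ⊆ image f (N G v))
    ⊆? u v = map′ (λ h {c} → h c) (λ h c → h {c}) (all? λ c → image? u c →-dec image? v c)

    ≐? : ∀ u v → Dec (image f (N G u) ≐ image f (N G v))
    ≐? u v = ⊆? u v ×-dec ⊆? v u

  id-proper : IsProperColoring G id
  id-proper = record
    { onto   = λ c → c , refl
    ; proper = λ a e → Graph.irrefl G e a
    }

  id-neighborLocating : IsNeighborLocating G id
  id-neighborLocating = record
    { isProper = id-proper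
    ; locating = λ u v u≢v e _ → u≢v e
    }

  hasNeighborLocating? : Decidable (HasNeighborLocating G)
  hasNeighborLocating? k = ∃-function? neighborLocating-resp neighborLocating?

  module _ (conn : Connected G) where

    colorCode-resp : ∀ {k} {f g : V → Fin k} → f ≗ g →
                     (p : IsProperColoring G f) (q : IsProperColoring G g) →
                     colorCode G conn f p ≗ colorCode G conn g q
    colorCode-resp {f = f} {g} f≗g p q v = tabulate-cong λ i → min-cong
      (distancesTo? G conn v (λ x → f x ≟ i)) (distancesTo-nonEmpty G conn v (onto p i))
      (distancesTo? G conn v (λ x → g x ≟ i)) (distancesTo-nonEmpty G conn v (onto q i))
      ( (λ { (x , e , d) → x , trans (sym (f≗g x)) e , d })
      , (λ { (x , e , d) → x , trans (f≗g x) e , d }))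

    locating-resp′ : ∀ {k} {f g : V → Fin k} → f ≗ g → (q : IsProperColoring G g) →
                     IsLocating G conn f → ∀ u v → u ≢ v →
                     colorCode G conn g q u ≢ colorCode G conn g q v
    locating-resp′ f≗g q l u v u≢v e = IsLocating.locating l u v u≢v
      (trans (colorCode-resp f≗g p q u) (trans e (sym (colorCode-resp f≗g p q v))))
      where p = IsLocating.isProper l

    locating-resp : ∀ {k} {f g : V → Fin k} → f ≗ g → IsLocating G conn f → IsLocating G conn g
    locating-resp f≗g l = record { isProper = q ; locating = locating-resp′ f≗g q l }
      where q = proper-resp f≗g (IsLocating.isProper l)

    locating? : ∀ {k} → Decidable (IsLocating G conn {k})
    locating? f with proper? f
    ... | no ¬p = no (¬p ∘ IsLocating.isProper)
    ... | yes p = map′ (λ l → record { isProper = p ; locating = l })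
                       (locating-resp′ (λ _ → refl) p)
                       (all? λ u → all? λ v → ¬? (u ≟ v) →-dec
                         ¬? (≡-dec _≟ℕ_ (colorCode G conn f p u) (colorCode G conn f p v)))

    dist-refl : ∀ u → dist G conn u u ≡ 0
    dist-refl u = n≤0⇒n≡0 (least (min-isMinimum (walk? G u u) (conn u u)) 0 [])

    dist≡0⇒≡ : ∀ {u v} → dist G conn u v ≡ 0 → u ≡ v
    dist≡0⇒≡ {u} {v} e
      with [] ← subst (Walk G u v) e (attained (min-isMinimum (walk? G u v) (conn u v))) = refl

    lookup-id-code : ∀ u i → lookup (colorCode G conn id id-proper u) i ≡ dist G conn u i
    lookup-id-code u i = trans (lookup∘tabulate _ i) (unique (attained
      (distSet-isMinimum G conn u {colorClass id i} (_≟ i) (i , refl))))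
      where
      unique : ∀ {n} → DistancesTo G conn u (colorClass id i) n → n ≡ dist G conn u i
      unique (_ , refl , e) = sym e

    id-locating : IsLocating G conn id
    id-locating = record
      { isProper = id-proper
      ; locating = λ u v u≢v e → u≢v (dist≡0⇒≡
          (trans (sym (lookup-id-code u v))
          (trans (cong (λ c → lookup c v) e)
          (trans (lookup-id-code v v) (dist-refl v)))))
      }

    hasLocating? : Decidable (HasLocating G conn)
    hasLocating? k = ∃-function? locating-resp locating?

χL₂ : Graph → ℕ
χL₂ G = min (hasNeighborLocating? G) (Graph.order G , id , id-neighborLocating G)

χL : (G : Graph) → Connected G → ℕ
χL G conn = min (hasLocating? G conn) (Graph.order G , id , id-locating G conn)

{-# OPTIONS --safe #-}

-- In a graph of diameter at most 2 a color code only records, for each color,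
-- whether it is the color of the vertex itself (0), of a neighbor (1), or of
-- neither (2); hence locating and neighbor locating colorings coincide. The
-- join has diameter at most 2, each summand sees every color of the other one,
-- and the two summands use disjoint sets of colors. So a neighbor locating
-- coloring of the join is the same thing as a pair of neighbor locating
-- colorings of the summands with disjoint palettes.

module Submission where

open import Defs
open import Data.Fin.Base using (Fin; zero; suc; splitAt; join; _↑ˡ_; _↑ʳ_)
open import Data.Fin.Properties using (_≟_; any?; injective⇒≤; splitAt-↑ˡ; splitAt-↑ʳ; splitAt⁻¹-↑ˡ; splitAt⁻¹-↑ʳ; ↑ˡ-injective; ↑ʳ-injective; join-splitAt)
open import Data.Nat.Base using (ℕ; zero; suc; _+_; _≤_; z≤n; s≤s)
open import Data.Nat.Properties using (≤-antisym; ≤-refl; ≤-trans; +-mono-≤; n≤0⇒n≡0)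
open import Data.Product.Base using (∃; ∃₂; _×_; _,_; proj₁; proj₂)
open import Data.Sum.Base using (_⊎_; inj₁; inj₂; [_,_]′)
open import Data.Unit.Base using (tt)
open import Data.Vec.Base using (lookup)
open import Data.Vec.Properties using (lookup∘tabulate; tabulate-cong)
open import Function.Base using (_∘_)
open import Function.Bundles using (_⇔_; mk⇔; Equivalence)
open import Function.Construct.Composition using (_⇔-∘_)
open import Function.Construct.Symmetry using (⇔-sym)
open import Function.Definitions using (Injective; StrictlySurjective)
open import Relation.Binary.PropositionalEquality.Core using (_≡_; _≢_; _≗_; refl; sym; trans; cong; subst)
open import Relation.Nullary.Decidable.Core using (yes; no)
open import Relation.Nullary.Negation.Core using (¬_; contradiction)
open import Relation.Unary using (_⊆_; _≐_)

open Graph using (Vertex; Adj)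
open IsMinimum
open IsProperColoring

-- Finite sets

↑ˡ⊎↑ʳ : ∀ m n (i : Fin (m + n)) → (∃ λ x → x ↑ˡ n ≡ i) ⊎ (∃ λ y → m ↑ʳ y ≡ i)
↑ˡ⊎↑ʳ m n i with splitAt m i in eq
... | inj₁ x = inj₁ (x , splitAt⁻¹-↑ˡ eq)
... | inj₂ y = inj₂ (y , splitAt⁻¹-↑ʳ eq)

↑ˡ≢↑ʳ : ∀ {m n} (x : Fin m) (y : Fin n) → x ↑ˡ n ≢ m ↑ʳ y
↑ˡ≢↑ʳ {m} {n} x y e
  with () ← trans (sym (splitAt-↑ˡ m x n)) (trans (cong (splitAt m) e) (splitAt-↑ʳ m n y))

-- Disjointness makes the copairing of the two injections injective. This bounds the total size of
-- two disjoint palettes.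
disjoint-injections⇒≤ : ∀ {m n k} {e₁ : Fin m → Fin k} {e₂ : Fin n → Fin k} →
                        Injective _≡_ _≡_ e₁ → Injective _≡_ _≡_ e₂ →
                        (∀ x y → e₁ x ≢ e₂ y) → m + n ≤ k
disjoint-injections⇒≤ {m} {n} {k} {e₁} {e₂} inj-e₁ inj-e₂ disjoint = injective⇒≤ {f = e ∘ splitAt m}
  λ {i} {j} eq → trans (sym (join-splitAt m n i))
    (trans (cong (join m n) (e-injective (splitAt m i) (splitAt m j) eq)) (join-splitAt m n j))
  where
  e : Fin m ⊎ Fin n → Fin k
  e = [ e₁ , e₂ ]′

  e-injective : ∀ a b → e a ≡ e b → a ≡ b
  e-injective (inj₁ x) (inj₁ y) eq = cong inj₁ (inj-e₁ eq)
  e-injective (inj₁ x) (inj₂ y) eq = contradiction eq (disjoint x y)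
  e-injective (inj₂ x) (inj₁ y) eq = contradiction (sym eq) (disjoint y x)
  e-injective (inj₂ x) (inj₂ y) eq = cong inj₂ (inj-e₂ eq)

-- A coloring must be onto, while one summand uses only some of the colors of the join. Here `surj`
-- is its coloring with the used colors renumbered, and `inj` recovers the original colors.
record ImageFactorization {n k} (g : Fin n → Fin k) : Set where
  field
    size       : ℕ
    surj       : Fin n → Fin size
    inj        : Fin size → Fin k
    surjective : StrictlySurjective _≡_ surj
    injective  : Injective _≡_ _≡_ inj
    factors    : g ≗ inj ∘ surj

imageFactorization : ∀ {n k} (g : Fin n → Fin k) → ImageFactorization g
imageFactorization {zero} g = record
  { size = 0 ; surj = λ () ; inj = λ () ; surjective = λ () ; injective = λ { {()} } ; factors = λ () }
imageFactorization {suc n} {k} g = extend (any? λ x → inj x ≟ g zero)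
  where
  open ImageFactorization (imageFactorization (g ∘ suc))

  extend : _ → ImageFactorization g
  extend (yes (x , e)) = record
    { surj       = λ { zero → x ; (suc i) → surj i }
    ; inj        = inj
    ; surjective = λ y → suc (proj₁ (surjective y)) , proj₂ (surjective y)
    ; injective  = injective
    ; factors    = λ { zero → sym e ; (suc i) → factors i }
    }
  -- A value not met before takes the index `zero` and shifts the others.
  extend (no g₀∉) = record
    { surj       = λ { zero → zero ; (suc i) → suc (surj i) }
    ; inj        = inj′
    ; surjective = λ { zero → zero , refl ; (suc y) → suc (proj₁ (surjective y)) , cong suc (proj₂ (surjective y)) }
    ; injective  = injective′ _ _
    ; factors    = λ { zero → refl ; (suc i) → factors i }
    }
    where
    inj′ : Fin (suc size) → Fin k
    inj′ zero    = g zero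
    inj′ (suc x) = inj x

    injective′ : ∀ x y → inj′ x ≡ inj′ y → x ≡ y
    injective′ zero    zero    _ = refl
    injective′ zero    (suc y) e = contradiction (y , sym e) g₀∉
    injective′ (suc x) zero    e = contradiction (x , e) g₀∉
    injective′ (suc x) (suc y) e = cong suc (injective e)

-- Color codes in graphs of diameter at most 2

-- Agreement on being 0 and on being 1 leaves 2 as the only other value.
≤2-determined : ∀ {m n} → m ≤ 2 → n ≤ 2 → m ≡ 0 ⇔ n ≡ 0 → m ≡ 1 ⇔ n ≡ 1 → m ≡ n
≤2-determined {0} _ _ e₀ _ = sym (Equivalence.to e₀ refl)
≤2-determined {1} _ _ _ e₁ = sym (Equivalence.to e₁ refl)
≤2-determined {2} {0} _ _ e₀ _ = Equivalence.from e₀ refl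
≤2-determined {2} {1} _ _ _ e₁ = Equivalence.from e₁ refl
≤2-determined {2} {2} _ _ _ _ = refl
≤2-determined {2} {suc (suc (suc _))} _ (s≤s (s≤s ())) _ _
≤2-determined {suc (suc (suc _))} (s≤s (s≤s ())) _ _ _

module _ (G : Graph) (conn : Connected G) where

  dist-isMinimum : ∀ u v → IsMinimum (Walk G u v) (dist G conn u v)
  dist-isMinimum u v = min-isMinimum (walk? G u v) (conn u v)

  dist≡1⇒adj : ∀ {u v} → dist G conn u v ≡ 1 → Adj G u v
  dist≡1⇒adj {u} {v} e with a ∷ [] ← subst (Walk G u v) e (attained (dist-isMinimum u v)) = a

  module Code {k} {f : Vertex G → Fin k} (isProper : IsProperColoring G f) where

    distToClass : Vertex G → Fin k → ℕ
    distToClass v i = distSet G conn v {colorClass f i} (λ x → f x ≟ i) (onto isProper i)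

    distToClass-isMinimum : ∀ v i → IsMinimum (DistancesTo G conn v (colorClass f i)) (distToClass v i)
    distToClass-isMinimum v i = distSet-isMinimum G conn v (λ x → f x ≟ i) (onto isProper i)

    distToClass≤ : ∀ {v w i n} → f w ≡ i → Walk G v w n → distToClass v i ≤ n
    distToClass≤ {v} {w} {i} {n} e p =
      ≤-trans (least (distToClass-isMinimum v i) _ (w , e , refl)) (least (dist-isMinimum v w) n p)

    distToClass≡0 : ∀ v i → distToClass v i ≡ 0 ⇔ f v ≡ i
    distToClass≡0 v i = mk⇔ to (λ e → n≤0⇒n≡0 (distToClass≤ e []))
      where
      to : distToClass v i ≡ 0 → f v ≡ i
      to d≡0 with x , fx≡i , e ← attained (distToClass-isMinimum v i) =
        trans (cong f (dist≡0⇒≡ G conn (trans e d≡0))) fx≡i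

    distToClass≡1 : ∀ v i → distToClass v i ≡ 1 ⇔ image f (N G v) i
    distToClass≡1 v i = mk⇔ to from
      where
      to : distToClass v i ≡ 1 → image f (N G v) i
      to d≡1 with x , fx≡i , e ← attained (distToClass-isMinimum v i) =
        x , dist≡1⇒adj (trans e d≡1) , fx≡i

      from : image f (N G v) i → distToClass v i ≡ 1
      -- The neighbor `x` bounds the distance by 1. Distance 0 would give `v` the color of `x`,
      -- against properness.
      from (x , a , fx≡i) with distToClass v i | distToClass≤ fx≡i (a ∷ []) | Equivalence.to (distToClass≡0 v i)
      ... | 0 | _ | fv≡i = contradiction (trans (fv≡i refl) (sym fx≡i)) (proper isProper a)
      ... | 1 | _ | _    = refl
      ... | suc (suc _) | s≤s () | _

    -- The 0 in a color code marks the color of the vertex, and the 1s mark the colors of its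
    -- neighbors.
    code-≡⇒ : ∀ {u v} → colorCode G conn f isProper u ≡ colorCode G conn f isProper v →
              f u ≡ f v × image f (N G u) ≐ image f (N G v)
    code-≡⇒ {u} {v} e = sym (Equivalence.to (distToClass≡0 v (f u)) (trans (sym (same (f u)))
                          (Equivalence.from (distToClass≡0 u (f u)) refl)))
                      , transfer same , transfer (sym ∘ same)
      where
      same : distToClass u ≗ distToClass v
      same i = trans (sym (lookup∘tabulate _ i)) (trans (cong (λ c → lookup c i) e) (lookup∘tabulate _ i))

      transfer : ∀ {u v} → distToClass u ≗ distToClass v → image f (N G u) ⊆ image f (N G v)
      transfer {u} {v} d≗ {i} c = Equivalence.to (distToClass≡1 v i)
        (trans (sym (d≗ i)) (Equivalence.from (distToClass≡1 u i) c))

  neighborLocating⇒locating : ∀ {k} {f : Vertex G → Fin k} → IsNeighborLocating G f → IsLocating G conn f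
  neighborLocating⇒locating l = record
    { isProper = isProper
    ; locating = λ u v u≢v e → let fu≡fv , same = code-≡⇒ e in locating u v u≢v fu≡fv same
    }
    where
    open IsNeighborLocating l
    open Code isProper

  DiameterAtMost2 : Set
  DiameterAtMost2 = ∀ u v → ∃ λ n → n ≤ 2 × Walk G u v n

  -- Equal colors and equal sets of neighbor colors put the 0s and the 1s of two codes in the same
  -- places. The diameter bound makes all other entries 2.
  locating⇒neighborLocating : DiameterAtMost2 → ∀ {k} {f : Vertex G → Fin k} →
                              IsLocating G conn f → IsNeighborLocating G f
  locating⇒neighborLocating diam {k} {f} l = record
    { isProper = isProper
    ; locating = λ u v u≢v fu≡fv (p , q) → locating u v u≢v (tabulate-cong λ i →
        ≤2-determined (distToClass≤2 u i) (distToClass≤2 v i)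
          (⇔-sym (distToClass≡0 v i) ⇔-∘ (mk⇔ (trans (sym fu≡fv)) (trans fu≡fv) ⇔-∘ distToClass≡0 u i))
          (⇔-sym (distToClass≡1 v i) ⇔-∘ (mk⇔ p q ⇔-∘ distToClass≡1 u i)))
    }
    where
    open IsLocating l
    open Code isProper

    distToClass≤2 : ∀ v i → distToClass v i ≤ 2
    distToClass≤2 v i =
      let w , fw≡i    = onto isProper i
          _ , n≤2 , p = diam v w
      in ≤-trans (distToClass≤ fw≡i p) n≤2

-- Summands of a join

-- The two sides of a join are treated at once: `G` is an induced subgraph of `H`, and each vertex
-- outside it is adjacent to all of it.
record Summand (G H : Graph) : Set where
  field
    ι           : Vertex G → Vertex H
    ι-injective : Injective _≡_ _≡_ ι
    adj         : ∀ {u v} → Adj G u v ⇔ Adj H (ι u) (ι v)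
    outside     : ∀ w → (∃ λ x → ι x ≡ w) ⊎ (∀ x → Adj H (ι x) w)

-- The map `e` embeds the palette of `g` into that of `f`. It is the inclusion of the used colors
-- when a coloring of the join is split, and `↑ˡ` or `↑ʳ` when two colorings are combined.
module Restriction {G H : Graph} (S : Summand G H)
                   {j k} {g : Vertex G → Fin j} {f : Vertex H → Fin k} {e : Fin j → Fin k}
                   (e-injective : Injective _≡_ _≡_ e) (f∘ι≗e∘g : f ∘ Summand.ι S ≗ e ∘ g) where
  open Summand S

  -- Neighbors outside `G` are common to `ι u` and `ι v`, so only the neighbors inside `G` have to
  -- be compared.
  image-extend : ∀ {u v} → image g (N G u) ⊆ image g (N G v) → image f (N H (ι u)) ⊆ image f (N H (ι v))
  image-extend {u} {v} sub (w , a , refl) with outside w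
  ... | inj₂ all = w , all v , refl
  ... | inj₁ (x , refl) with y , b , gy≡gx ← sub (x , Equivalence.from adj a , refl) =
    ι y , Equivalence.to adj b , trans (f∘ι≗e∘g y) (trans (cong e gy≡gx) (sym (f∘ι≗e∘g x)))

  g-≡ : ∀ {x y} → f (ι x) ≡ f (ι y) → g x ≡ g y
  g-≡ eq = e-injective (trans (sym (f∘ι≗e∘g _)) (trans eq (f∘ι≗e∘g _)))

  f-≡ : ∀ {x y} → g x ≡ g y → f (ι x) ≡ f (ι y)
  f-≡ eq = trans (f∘ι≗e∘g _) (trans (cong e eq) (sym (f∘ι≗e∘g _)))

  -- A color of a vertex of G cannot occur outside G, where every vertex is adjacent to it.
  image-restrict : IsProperColoring H f → ∀ {u v} →
                   image f (N H (ι u)) ⊆ image f (N H (ι v)) → image g (N G u) ⊆ image g (N G v)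
  image-restrict p sub (x , a , refl) with w , b , fw≡ ← sub (ι x , Equivalence.to adj a , refl) | outside w
  ... | inj₂ all = contradiction (sym fw≡) (proper p (all x))
  ... | inj₁ (y , refl) = y , Equivalence.from adj b , g-≡ fw≡

  restrict : StrictlySurjective _≡_ g → IsNeighborLocating H f → IsNeighborLocating G g
  restrict g-onto l = record
    { isProper = record { onto = g-onto ; proper = λ a eq → proper isProper (Equivalence.to adj a) (f-≡ eq) }
    ; locating = λ u v u≢v eq (p , q) →
        locating (ι u) (ι v) (u≢v ∘ ι-injective) (f-≡ eq) (image-extend p , image-extend q)
    }
    where open IsNeighborLocating l

  extend-proper : IsProperColoring G g → ∀ {u v} → Adj H (ι u) (ι v) → f (ι u) ≢ f (ι v)
  extend-proper p a eq = proper p (Equivalence.from adj a) (g-≡ eq)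

  extend-locating : IsProperColoring H f → IsNeighborLocating G g → ∀ u v → ι u ≢ ι v →
                    f (ι u) ≡ f (ι v) → ¬ (image f (N H (ι u)) ≐ image f (N H (ι v)))
  extend-locating p l u v ιu≢ιv eq (q , r) =
    IsNeighborLocating.locating l u v (ιu≢ιv ∘ cong ι) (g-≡ eq) (image-restrict p q , image-restrict p r)

-- Neighbor locating colorings of a join

module _ (G₁ G₂ : Graph) where
  private
    H = G₁ +ᴳ G₂
    n₁ = Graph.order G₁
    n₂ = Graph.order G₂
    open Join G₁ G₂ using (Adj⊎; someVertex)

    inl : Vertex G₁ → Vertex H
    inl x = x ↑ˡ n₂

    inr : Vertex G₂ → Vertex H
    inr y = n₁ ↑ʳ y

    -- Adjacency in `H` is defined through `splitAt`, which does not reduce on `inl x` or `inr y`;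
    -- the equations supply its values.
    adj-via : ∀ {u v a b} → splitAt n₁ u ≡ a → splitAt n₁ v ≡ b → Adj⊎ a b ⇔ Adj H u v
    adj-via refl refl = mk⇔ (λ a → a) (λ a → a)

    split-inl : ∀ x → splitAt n₁ (inl x) ≡ inj₁ x
    split-inl x = splitAt-↑ˡ n₁ x n₂

    split-inr : ∀ y → splitAt n₁ (inr y) ≡ inj₂ y
    split-inr = splitAt-↑ʳ n₁ n₂

    inl~inr : ∀ x y → Adj H (inl x) (inr y)
    inl~inr x y = Equivalence.to (adj-via {inl x} {inr y} (split-inl x) (split-inr y)) tt

    inr~inl : ∀ y x → Adj H (inr y) (inl x)
    inr~inl y x = Graph.symm H {inl x} {inr y} (inl~inr x y)

    cover : ∀ w → (∃ λ x → inl x ≡ w) ⊎ (∃ λ y → inr y ≡ w)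
    cover = ↑ˡ⊎↑ʳ n₁ n₂

  left : Summand G₁ H
  left = record
    { ι           = inl
    ; ι-injective = ↑ˡ-injective n₂ _ _
    ; adj         = λ {u} {v} → adj-via {inl u} {inl v} (split-inl u) (split-inl v)
    ; outside     = λ w → [ inj₁ , (λ { (y , refl) → inj₂ λ x → inl~inr x y }) ]′ (cover w)
    }

  right : Summand G₂ H
  right = record
    { ι           = inr
    ; ι-injective = ↑ʳ-injective n₁ _ _
    ; adj         = λ {u} {v} → adj-via {inr u} {inr v} (split-inr u) (split-inr v)
    ; outside     = λ w → [ (λ { (x , refl) → inj₂ λ y → inr~inl y x }) , inj₁ ]′ (cover w)
    }

  +ᴳ-diameter : DiameterAtMost2 H (+ᴳ-connected G₁ G₂)
  +ᴳ-diameter u v with cover u | cover v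
  ... | inj₁ (x , refl) | inj₂ (y , refl) = 1 , s≤s z≤n , inl~inr x y ∷ []
  ... | inj₂ (y , refl) | inj₁ (x , refl) = 1 , s≤s z≤n , inr~inl y x ∷ []
  -- Two vertices on the same side are linked through a vertex of the other side, which is nonempty.
  ... | inj₁ (x , refl) | inj₁ (x′ , refl) = 2 , ≤-refl , inl~inr x y ∷ (inr~inl y x′ ∷ [])
    where y = someVertex (Graph.nonEmpty G₂)
  ... | inj₂ (y , refl) | inj₂ (y′ , refl) = 2 , ≤-refl , inr~inl y x ∷ (inl~inr x y′ ∷ [])
    where x = someVertex (Graph.nonEmpty G₁)

  -- The first `k₁` colors go to `G₁` and the last `k₂` to `G₂`. Vertices of equal color then lie in
  -- the same summand, where the given coloring tells them apart.
  combine-neighborLocating : ∀ {k₁ k₂} → HasNeighborLocating G₁ k₁ → HasNeighborLocating G₂ k₂ →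
                             HasNeighborLocating H (k₁ + k₂)
  combine-neighborLocating {k₁} {k₂} (f₁ , l₁) (f₂ , l₂) = f , record { isProper = f-proper ; locating = f-locating }
    where
    p₁ = IsNeighborLocating.isProper l₁
    p₂ = IsNeighborLocating.isProper l₂

    f⊎ : Vertex G₁ ⊎ Vertex G₂ → Fin (k₁ + k₂)
    f⊎ = [ (λ x → f₁ x ↑ˡ k₂) , (λ y → k₁ ↑ʳ f₂ y) ]′

    f : Vertex H → Fin (k₁ + k₂)
    f = f⊎ ∘ splitAt n₁

    f-inl : ∀ x → f (inl x) ≡ f₁ x ↑ˡ k₂
    f-inl x = cong f⊎ (split-inl x)

    f-inr : ∀ y → f (inr y) ≡ k₁ ↑ʳ f₂ y
    f-inr y = cong f⊎ (split-inr y)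

    inl≢inr : ∀ x y → f (inl x) ≢ f (inr y)
    inl≢inr x y eq = ↑ˡ≢↑ʳ (f₁ x) (f₂ y) (trans (sym (f-inl x)) (trans eq (f-inr y)))

    module L = Restriction left {g = f₁} {f} (↑ˡ-injective k₂ _ _) f-inl
    module R = Restriction right {g = f₂} {f} (↑ʳ-injective k₁ _ _) f-inr

    f-onto : StrictlySurjective _≡_ f
    f-onto c with ↑ˡ⊎↑ʳ k₁ k₂ c
    ... | inj₁ (c₁ , refl) with x , refl ← onto p₁ c₁ = inl x , f-inl x
    ... | inj₂ (c₂ , refl) with y , refl ← onto p₂ c₂ = inr y , f-inr y

    f-adj : ∀ u v → Adj H u v → f u ≢ f v
    f-adj u v a with cover u | cover v
    ... | inj₁ (x , refl) | inj₁ (x′ , refl) = L.extend-proper p₁ a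
    ... | inj₁ (x , refl) | inj₂ (y , refl)  = inl≢inr x y
    ... | inj₂ (y , refl) | inj₁ (x , refl)  = inl≢inr x y ∘ sym
    ... | inj₂ (y , refl) | inj₂ (y′ , refl) = R.extend-proper p₂ a

    f-proper : IsProperColoring H f
    f-proper = record { onto = f-onto ; proper = λ {u} {v} → f-adj u v }

    f-locating : ∀ u v → u ≢ v → f u ≡ f v → ¬ (image f (N H u) ≐ image f (N H v))
    f-locating u v u≢v eq with cover u | cover v
    ... | inj₁ (x , refl) | inj₁ (x′ , refl) = L.extend-locating f-proper l₁ x x′ u≢v eq
    ... | inj₁ (x , refl) | inj₂ (y , refl)  = contradiction eq (inl≢inr x y)
    ... | inj₂ (y , refl) | inj₁ (x , refl)  = contradiction (sym eq) (inl≢inr x y)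
    ... | inj₂ (y , refl) | inj₂ (y′ , refl) = R.extend-locating f-proper l₂ y y′ u≢v eq

  -- Each summand keeps the colors that it uses, renumbered.
  split-neighborLocating : ∀ {k} → HasNeighborLocating H k →
                           ∃₂ λ k₁ k₂ → HasNeighborLocating G₁ k₁ × HasNeighborLocating G₂ k₂ × k₁ + k₂ ≤ k
  split-neighborLocating {k} (f , l) =
    F₁.size , F₂.size ,
    (F₁.surj , Restriction.restrict left F₁.injective F₁.factors F₁.surjective l) ,
    (F₂.surj , Restriction.restrict right F₂.injective F₂.factors F₂.surjective l) ,
    disjoint-injections⇒≤ F₁.injective F₂.injective disjoint
    where
    module F₁ = ImageFactorization (imageFactorization (f ∘ inl))
    module F₂ = ImageFactorization (imageFactorization (f ∘ inr))

    disjoint : ∀ c₁ c₂ → F₁.inj c₁ ≢ F₂.inj c₂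
    -- A shared color would occur on both sides of the join, hence at two adjacent vertices.
    disjoint c₁ c₂ eq with x , refl ← F₁.surjective c₁ | y , refl ← F₂.surjective c₂ =
      proper (IsNeighborLocating.isProper l) (inl~inr x y)
        (trans (F₁.factors x) (trans eq (sym (F₂.factors y))))

-- Comparison of the minimum numbers of colors

χL-isMinimum : ∀ G conn → IsMinimum (HasLocating G conn) (χL G conn)
χL-isMinimum G conn = min-isMinimum (hasLocating? G conn) _

χL₂-isMinimum : ∀ G → IsMinimum (HasNeighborLocating G) (χL₂ G)
χL₂-isMinimum G = min-isMinimum (hasNeighborLocating? G) _

theorem1 : (G₁ G₂ : Graph) → χL (G₁ +ᴳ G₂) (+ᴳ-connected G₁ G₂) ≡ χL₂ G₁ + χL₂ G₂
theorem1 G₁ G₂ = ≤-antisym χL≤ ≤χL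
  where
  H = G₁ +ᴳ G₂
  conn = +ᴳ-connected G₁ G₂

  χL≤ : χL H conn ≤ χL₂ G₁ + χL₂ G₂
  χL≤ with f , l ← combine-neighborLocating G₁ G₂ (attained (χL₂-isMinimum G₁)) (attained (χL₂-isMinimum G₂)) =
    least (χL-isMinimum H conn) _ (f , neighborLocating⇒locating H conn l)

  ≤χL : χL₂ G₁ + χL₂ G₂ ≤ χL H conn
  -- An optimal locating coloring of the join is neighbor locating by the diameter bound, so it can
  -- be split between the summands.
  ≤χL with f , l ← attained (χL-isMinimum H conn)
    with k₁ , k₂ , h₁ , h₂ , k₁+k₂≤ ← split-neighborLocating G₁ G₂ (f , locating⇒neighborLocating H conn (+ᴳ-diameter G₁ G₂) l) =
    ≤-trans (+-mono-≤ (least (χL₂-isMinimum G₁) k₁ h₁) (least (χL₂-isMinimum G₂) k₂ h₂)) k₁+k₂≤
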